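{- For every finite simple graph $G$ with chromatic number $\chi(G) \geq 2$, we have $\operatorname{tlir}(G) \leq 2\chi(G) - 2$.
   Context: A total coloring of $G$ assigns a color to every vertex and every edge of $G$. For a color $c$ and a vertex $v$, the total $c$-degree of $v$ is the number of edges of color $c$ incident to $v$, plus $1$ if $v$ itself has color $c$. A total coloring is a locally irregular total coloring (TLIR coloring) if for every edge $uv$, with $c$ the color of $uv$, the total $c$-degrees of $u$ and $v$ differ. $\operatorname{tlir}(G)$ is the minimum number of colors in a TLIR coloring of $G$. -}

module Defs where

open import Data.Nat using (ℕ; zero; suc; _+_; _≤_)
open import Data.Fin using (Fin)
open import Data.Fin.Properties using (_≟_)
open import Data.Bool using (Bool; true; false; if_then_else_; _∧_)
open import Data.List using (List; []; _∷_)
open import Data.List.Base using (allFin)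
open import Data.Product using (Σ; _×_; _,_)
open import Relation.Binary.PropositionalEquality using (_≡_; _≢_)
open import Relation.Nullary using (¬_; Dec; yes; no)
open import Relation.Nullary.Decidable using (⌊_⌋)

record Graph (n : ℕ) : Set where
  field
    adj     : Fin n → Fin n → Bool
    sym     : ∀ u v → adj u v ≡ adj v u
    irrefl  : ∀ v → adj v v ≡ false

open Graph public

Adj : ∀ {n} → Graph n → Fin n → Fin n → Set
Adj G u v = adj G u v ≡ true

IsProperColoring : ∀ {n} (G : Graph n) (k : ℕ) → (Fin n → Fin k) → Set
IsProperColoring G k f = ∀ u v → Adj G u v → f u ≢ f v

Colorable : ∀ {n} → Graph n → ℕ → Set
Colorable {n} G k = Σ (Fin n → Fin k) (IsProperColoring G k)

IsChromaticNumber : ∀ {n} → Graph n → ℕ → Set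
IsChromaticNumber G k = Colorable G k × (∀ j → Colorable G j → k ≤ j)

-- A total colouring with k colours: a colour for every vertex and a colour
-- for every edge. Edge colours are given by a function on ordered pairs
-- which must be symmetric on edges (so that uv and vu get the same colour);
-- values on non-adjacent pairs are irrelevant.
record TotalColoring {n} (G : Graph n) (k : ℕ) : Set where
  field
    vcol    : Fin n → Fin k
    ecol    : Fin n → Fin n → Fin k
    ecolSym : ∀ u v → Adj G u v → ecol u v ≡ ecol v u

open TotalColoring public

countTrue : ∀ {A : Set} → (A → Bool) → List A → ℕ
countTrue p [] = 0
countTrue p (x ∷ xs) = (if p x then 1 else 0) + countTrue p xs

isColor : ∀ {k} → Fin k → Fin k → Bool
isColor c d = ⌊ c ≟ d ⌋

totalDeg : ∀ {n k} {G : Graph n} → TotalColoring G k → Fin k → Fin n → ℕ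
totalDeg {n} {k} {G} T c v =
  countTrue (λ w → adj G v w ∧ isColor (ecol T v w) c) (allFin n)
  + (if isColor (vcol T v) c then 1 else 0)

IsTLIR : ∀ {n k} {G : Graph n} → TotalColoring G k → Set
IsTLIR {G = G} T = ∀ u v → Adj G u v →
  totalDeg T (ecol T u v) u ≢ totalDeg T (ecol T u v) v

-- G admits a TLIR colouring using (at most) k colours, i.e. tlir(G) ≤ k.
HasTLIR : ∀ {n} → Graph n → ℕ → Set
HasTLIR G k = Σ (TotalColoring G k) IsTLIR

module Submission where

-- Peel off one colour class A of a proper colouring: the edges leaving A get two new colours, red
-- and blue, and the vertices of A may be red or blue, while the rest L of the graph is handled by
-- induction (two classes need only one edge colour: vertex colours make the total degrees odd on
-- one side and even on the other).  A vertex l of L has no red or blue of its own, so the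
-- A–L graph must be made irregular by vertex colours in A only.
--
-- Each a in A in turn claims all its still unclaimed neighbours l of odd degree, except that an
-- a of odd degree > 1 never claims just a single one.  A claimed l gets its edge to its owner
-- red and the others blue; an unclaimed l of odd degree > 1 gets only red edges; all other l get
-- only blue edges.  Blue degrees in L are then even, up to unclaimed l of degree 1, and vertex
-- colours make the blue total of every a with a blue edge odd.  A vertex a owning a single red
-- edge either has even degree, so is itself red, or has degree 1 and no blue edge, so may be
-- red as well.  Finally, the neighbours a of an unclaimed odd l have odd degree > 1, own nothing
-- and have no other unclaimed odd neighbour: if deg l > 1 then a has red total 1, and if deg l = 1
-- then all edges at a are blue.

open import Defs hiding (sym)
open import Algebra.Properties.CommutativeSemigroup using (interchange)
open import Data.Bool using (Bool; true; false; if_then_else_; _∧_; _∨_; _xor_; not)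
open import Data.Bool.Properties as Bool
  using (∧-conicalˡ; ∧-conicalʳ; ∧-comm; ∧-zeroʳ; ∧-identityʳ; xor-assoc; xor-same; not-¬; ¬-not)
open import Data.Empty using (⊥-elim)
open import Data.Fin using (Fin; zero; suc)
open import Data.Fin.Properties using (_≟_; any?; all?; ¬∀⟶∃¬; suc-injective)
open import Data.List.Base using (tabulate)
open import Data.Maybe using (Maybe; just; nothing; map)
open import Data.Nat using (ℕ; zero; suc; _+_; _≤_; _*_; _∸_; _≡ᵇ_; s≤s)
open import Data.Nat.Properties using (*-comm; +-identityʳ; +-commutativeSemigroup)
open import Data.Product using (∃; _×_; _,_; proj₁; proj₂)
open import Function using (_∘_; id)
open import Relation.Binary.PropositionalEquality
open import Relation.Nullary using (¬_; Dec; yes; no; contradiction)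
open import Relation.Nullary.Decidable using (_→-dec_; _×-dec_; ¬?; decidable-stable)

-- Parity and counting over `Fin n`.

bit : Bool → ℕ
bit b = if b then 1 else 0

odd : ℕ → Bool
odd zero    = false
odd (suc n) = not (odd n)

odd-+ : ∀ m n → odd (m + n) ≡ odd m xor odd n
odd-+ zero    n = refl
odd-+ (suc m) n with odd m | odd-+ m n
... | true  | e = trans (cong not e) (Bool.not-involutive _)
... | false | e = cong not e

odd-bit : ∀ b → odd (bit b) ≡ b
odd-bit true  = refl
odd-bit false = refl

-- Recursion on `Fin n` itself avoids the list `allFin n`; `countTrue-tabulate` is the bridge to
-- `totalDeg`.
count : ∀ {n} → (Fin n → Bool) → ℕ
count {zero}  p = 0
count {suc n} p = bit (p zero) + count (p ∘ suc)

countTrue-tabulate : ∀ {n} {A : Set} (p : A → Bool) (g : Fin n → A) →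
  countTrue p (tabulate g) ≡ count (p ∘ g)
countTrue-tabulate {zero}  p g = refl
countTrue-tabulate {suc n} p g = cong (bit (p (g zero)) +_) (countTrue-tabulate p (g ∘ suc))

count-cong : ∀ {n} {p q : Fin n → Bool} → (∀ i → p i ≡ q i) → count p ≡ count q
count-cong {zero}  e = refl
count-cong {suc n} e = cong₂ _+_ (cong bit (e zero)) (count-cong (e ∘ suc))

count-split : ∀ {n} (p q : Fin n → Bool) →
  count p ≡ count (λ i → p i ∧ q i) + count (λ i → p i ∧ not (q i))
count-split {zero}  p q = refl
count-split {suc n} p q = trans
  (cong₂ _+_ (bit-split (p zero) (q zero)) (count-split (p ∘ suc) (q ∘ suc)))
  (interchange +-commutativeSemigroup (bit (p zero ∧ q zero)) _ _ _)
  where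
  bit-split : ∀ b c → bit b ≡ bit (b ∧ c) + bit (b ∧ not c)
  bit-split true  true  = refl
  bit-split true  false = refl
  bit-split false c     = refl

count-none : ∀ {n} {p : Fin n → Bool} → (∀ i → p i ≢ true) → count p ≡ 0
count-none {zero}  none = refl
count-none {suc n} {p} none rewrite ¬-not (none zero) = count-none (none ∘ suc)

count-single : ∀ {n} {p : Fin n → Bool} i → p i ≡ true → (∀ j → p j ≡ true → j ≡ i) →
  count p ≡ 1
count-single zero pi only rewrite pi =
  cong suc (count-none λ j pj → contradiction (only (suc j) pj) λ ())
count-single {p = p} (suc i) pi only
  rewrite ¬-not {p zero} {true} (λ p0 → contradiction (only zero p0) λ ()) =
  count-single i pi λ j pj → suc-injective (only (suc j) pj)

count≢0 : ∀ {n} {p : Fin n → Bool} i → p i ≡ true → count p ≢ 0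
count≢0 zero    pi e rewrite pi = contradiction e λ ()
count≢0 {p = p} (suc i) pi e with p zero
... | true  = contradiction e λ ()
... | false = count≢0 i pi e

count≡1⇒unique : ∀ {n} {p : Fin n → Bool} {i j} → count p ≡ 1 → p i ≡ true → p j ≡ true → i ≡ j
count≡1⇒unique {i = zero}  {zero}  e pi pj = refl
count≡1⇒unique {i = zero}  {suc j} e pi pj rewrite pi = ⊥-elim (count≢0 j pj (cong (_∸ 1) e))
count≡1⇒unique {i = suc i} {zero}  e pi pj rewrite pj = ⊥-elim (count≢0 i pi (cong (_∸ 1) e))
count≡1⇒unique {p = p} {suc i} {suc j} e pi pj with p zero
... | true  = ⊥-elim (count≢0 i pi (cong (_∸ 1) e))
... | false = cong suc (count≡1⇒unique e pi pj)

-- Greedy claiming of columns by rows.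

record IsClaim {p q} (E : Fin p → Fin q → Bool) (shy : Fin p → Bool) (free : Fin q → Bool)
               (f : Fin q → Maybe (Fin p)) : Set where
  field
    claim-edge  : ∀ {a l} → f l ≡ just a → E a l ≡ true
    claim-free  : ∀ {a l} → f l ≡ just a → free l ≡ true
    -- A shy row never owns exactly one column. Later, `shy` means odd degree above 1, and `free`
    -- means odd degree.
    shy-claim   : ∀ {a l} → shy a ≡ true → f l ≡ just a → ∃ λ l′ → l′ ≢ l × f l′ ≡ just a
    -- A row passes over a free column only if it is shy and this is the sole free column it meets
    -- at its turn. Columns still free at the end were free at that turn, which gives the three
    -- `left-` fields.
    left-shy    : ∀ {a l} → f l ≡ nothing → free l ≡ true → E a l ≡ true → shy a ≡ true
    left-idle   : ∀ {a l} → f l ≡ nothing → free l ≡ true → E a l ≡ true → ∀ l′ → f l′ ≢ just a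
    left-unique : ∀ {a l l′} → f l ≡ nothing → free l ≡ true → E a l ≡ true →
                  f l′ ≡ nothing → free l′ ≡ true → E a l′ ≡ true → l ≡ l′

open IsClaim

map-suc-just : ∀ {p} (m : Maybe (Fin p)) {a} → map suc m ≡ just (Fin.suc a) → m ≡ just a
map-suc-just (just _) refl = refl

map-suc-nothing : ∀ {p} (m : Maybe (Fin p)) → map Fin.suc m ≡ nothing → m ≡ nothing
map-suc-nothing nothing refl = refl

map-suc-zero : ∀ {p} (m : Maybe (Fin p)) → map Fin.suc m ≢ just zero
map-suc-zero (just _) ()
map-suc-zero nothing  ()

module _ {p q} {E : Fin (suc p) → Fin q → Bool} {shy : Fin (suc p) → Bool} {free : Fin q → Bool}
         {f : Fin q → Maybe (Fin p)} where

  private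
    Row : Fin q → Set
    Row l = E zero l ≡ true × free l ≡ true

  -- Row `zero` passes: the two hypotheses are `left-shy` and `left-unique` at `zero`, and owners
  -- shifted by `suc` are never `zero`, which settles the other fields there.
  claim-none : shy zero ≡ true → (∀ {l l′} → Row l → Row l′ → l ≡ l′) →
    IsClaim (E ∘ suc) (shy ∘ suc) free f → IsClaim E shy free (map suc ∘ f)
  claim-none sh lone C .claim-edge {zero}  {l} e = contradiction e (map-suc-zero (f l))
  claim-none sh lone C .claim-edge {suc a} {l} e = claim-edge C (map-suc-just (f l) e)
  claim-none sh lone C .claim-free {zero}  {l} e = contradiction e (map-suc-zero (f l))
  claim-none sh lone C .claim-free {suc a} {l} e = claim-free C (map-suc-just (f l) e)
  claim-none sh lone C .shy-claim {zero}  {l} s e = contradiction e (map-suc-zero (f l))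
  claim-none sh lone C .shy-claim {suc a} {l} s e with shy-claim C s (map-suc-just (f l) e)
  ... | l′ , l′≢l , e′ = l′ , l′≢l , cong (map suc) e′
  claim-none sh lone C .left-shy {zero}      n v e = sh
  claim-none sh lone C .left-shy {suc a} {l} n v e = left-shy C (map-suc-nothing (f l) n) v e
  claim-none sh lone C .left-idle {zero}      n v e l′ j = map-suc-zero (f l′) j
  claim-none sh lone C .left-idle {suc a} {l} n v e l′ j =
    left-idle C (map-suc-nothing (f l) n) v e l′ (map-suc-just (f l′) j)
  claim-none sh lone C .left-unique {zero} n v e n′ v′ e′ = lone (e , v) (e′ , v′)
  claim-none sh lone C .left-unique {suc a} {l} {l′} n v e n′ v′ e′ =
    left-unique C (map-suc-nothing (f l) n) v e (map-suc-nothing (f l′) n′) v′ e′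

  row : Fin q → Bool
  row l = E zero l ∧ free l

  grab : Fin q → Maybe (Fin (suc p))
  grab l = if row l then just zero else map suc (f l)

  -- After row `zero` has taken every free column it meets, its `left-` fields are vacuous. The
  -- later rows choose among the remaining free columns only, so their claims never collide with
  -- `row`.
  claim-all : (shy zero ≡ true → ∀ {l} → row l ≡ true → ∃ λ l′ → l′ ≢ l × row l′ ≡ true) →
    IsClaim (E ∘ suc) (shy ∘ suc) (λ l → free l ∧ not (row l)) f → IsClaim E shy free grab
  claim-all many C = proof
    where
    grab-zero : ∀ {l} → grab l ≡ just zero → row l ≡ true
    grab-zero {l} e with row l
    ... | true  = refl
    ... | false = contradiction e (map-suc-zero (f l))

    row-grab : ∀ {l} → row l ≡ true → grab l ≡ just zero
    row-grab e rewrite e = refl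

    grab-suc : ∀ {l a} → grab l ≡ just (suc a) → f l ≡ just a
    grab-suc {l} e with row l
    ... | false = map-suc-just (f l) e

    row-unclaimed : ∀ {l a} → f l ≡ just a → row l ≡ false
    row-unclaimed e = Bool.not-injective (∧-conicalʳ _ _ (claim-free C e))

    suc-grab : ∀ {l a} → f l ≡ just a → grab l ≡ just (suc a)
    suc-grab e rewrite row-unclaimed e = cong (map suc) e

    grab-nothing : ∀ {l} → grab l ≡ nothing → row l ≡ false × f l ≡ nothing
    grab-nothing {l} e with row l
    ... | false = refl , map-suc-nothing (f l) e

    ¬row : ∀ {l} → grab l ≡ nothing → free l ≡ true → E zero l ≢ true
    ¬row n v e with trans (sym (cong₂ _∧_ e v)) (proj₁ (grab-nothing n))
    ... | ()

    still-free : ∀ {l} → grab l ≡ nothing → free l ≡ true → free l ∧ not (row l) ≡ true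
    still-free n v = cong₂ (λ b c → b ∧ not c) v (proj₁ (grab-nothing n))

    proof : IsClaim E shy free grab
    proof .claim-edge {zero}  e = ∧-conicalˡ _ _ (grab-zero e)
    proof .claim-edge {suc a} e = claim-edge C (grab-suc e)
    proof .claim-free {zero} {l} e = ∧-conicalʳ (E zero l) _ (grab-zero e)
    proof .claim-free {suc a} e = ∧-conicalˡ _ _ (claim-free C (grab-suc e))
    proof .shy-claim {zero} s e with many s (grab-zero e)
    ... | l′ , l′≢l , r = l′ , l′≢l , row-grab r
    proof .shy-claim {suc a} s e with shy-claim C s (grab-suc e)
    ... | l′ , l′≢l , e′ = l′ , l′≢l , suc-grab e′
    proof .left-shy {zero}  n v e = contradiction e (¬row n v)
    proof .left-shy {suc a} n v e = left-shy C (proj₂ (grab-nothing n)) (still-free n v) e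
    proof .left-idle {zero}  n v e = contradiction e (¬row n v)
    proof .left-idle {suc a} n v e l′ j =
      left-idle C (proj₂ (grab-nothing n)) (still-free n v) e l′ (grab-suc j)
    proof .left-unique {zero}  n v e = contradiction e (¬row n v)
    proof .left-unique {suc a} n v e n′ v′ e′ =
      left-unique C (proj₂ (grab-nothing n)) (still-free n v) e
                    (proj₂ (grab-nothing n′)) (still-free n′ v′) e′

claim : ∀ {p q} (E : Fin p → Fin q → Bool) shy free → ∃ (IsClaim E shy free)
claim {zero} E shy free = (λ _ → nothing) , record
  { claim-edge = λ () ; claim-free = λ () ; shy-claim = λ { {()} }
  ; left-shy = λ { {()} } ; left-idle = λ { {()} } ; left-unique = λ { {()} } }
claim {suc p} {q} E shy free = result
  where
  r : Fin q → Bool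
  r l = E zero l ∧ free l

  Accompanied : Fin q → Set
  Accompanied l = r l ≡ true → ∃ λ l′ → l′ ≢ l × r l′ ≡ true

  accompanied? : ∀ l → Dec (Accompanied l)
  accompanied? l = (r l Bool.≟ true) →-dec any? λ l′ → ¬? (l′ ≟ l) ×-dec (r l′ Bool.≟ true)

  take-all : (shy zero ≡ true → ∀ {l} → Accompanied l) → ∃ (IsClaim E shy free)
  take-all many = _ , claim-all many (proj₂ (claim (E ∘ suc) (shy ∘ suc) _))

  lone : ∀ {l} → ¬ Accompanied l → ∀ {l′} → r l′ ≡ true → l′ ≡ l
  lone {l} ¬acc {l′} e = decidable-stable (l′ ≟ l) λ l′≢l → ¬acc λ _ → l′ , l′≢l , e

  result : ∃ (IsClaim E shy free)
  result with shy zero in s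
  ... | false = take-all λ t → contradiction (trans (sym t) s) λ ()
  ... | true with all? accompanied?
  ...   | yes acc = take-all λ _ → acc _
  -- The failing column `l` is the only free one in the row, so a shy row has to pass.
  ...   | no ¬acc with ¬∀⟶∃¬ q Accompanied accompanied? ¬acc
  ...     | l , ¬al = _ , claim-none s
              (λ (e , v) (e′ , v′) →
                trans (lone ¬al (cong₂ _∧_ e v)) (sym (lone ¬al (cong₂ _∧_ e′ v′))))
              (proj₂ (claim (E ∘ suc) (shy ∘ suc) free))

-- Colour tests and parity tests.

isColor-refl : ∀ {k} (c : Fin k) → isColor c c ≡ true
isColor-refl c with c ≟ c
... | yes _  = refl
... | no c≢c = contradiction refl c≢c

isColor⇒≡ : ∀ {k} {c d : Fin k} → isColor c d ≡ true → c ≡ d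
isColor⇒≡ {c = c} {d} e with c ≟ d
... | yes c≡d = c≡d

∧-split : ∀ {b c} → b ∧ c ≡ true → b ≡ true × c ≡ true
∧-split {b} {c} e = ∧-conicalˡ b c e , ∧-conicalʳ b c e

true≢false : ∀ {b} → b ≡ true → b ≢ false
true≢false refl ()

differ : ∀ {m n b} → odd m ≡ b → odd n ≡ not b → m ≢ n
differ om on refl = not-¬ om on

oddAbove1 : ℕ → Bool
oddAbove1 d = odd d ∧ not (d ≡ᵇ 1)

oddAbove1⇒≢1 : ∀ {d} → oddAbove1 d ≡ true → d ≢ 1
oddAbove1⇒≢1 () refl

¬oddAbove1⇒≡1 : ∀ {d} → odd d ≡ true → oddAbove1 d ≡ false → d ≡ 1
¬oddAbove1⇒≡1 {1} o v = refl
¬oddAbove1⇒≡1 {suc (suc d)} o v = contradiction v (true≢false (cong (_∧ true) o))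

-- The red-blue colouring of a bipartite graph, with vertex colours on the rows only.

module Bipartite {p q} (E : Fin p → Fin q → Bool) where

  rowDeg : Fin p → ℕ
  rowDeg a = count (E a)

  colDeg : Fin q → ℕ
  colDeg l = count (λ a → E a l)

  claiming : ∃ (IsClaim E (oddAbove1 ∘ rowDeg) (odd ∘ colDeg))
  claiming = claim E (oddAbove1 ∘ rowDeg) (odd ∘ colDeg)

  f = proj₁ claiming
  C = proj₂ claiming

  paint : Maybe (Fin p) → Bool → Fin p → Bool
  paint (just c) b a = isColor a c
  paint nothing  b a = b

  isRed : Fin p → Fin q → Bool
  isRed a l = paint (f l) (oddAbove1 (colDeg l)) a

  rowRed rowBlue : Fin p → ℕ
  rowRed  a = count (λ l → E a l ∧ isRed a l)
  rowBlue a = count (λ l → E a l ∧ not (isRed a l))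

  colRed colBlue : Fin q → ℕ
  colRed  l = count (λ a → E a l ∧ isRed a l)
  colBlue l = count (λ a → E a l ∧ not (isRed a l))

  -- A blue edge at a is meant to see an odd blue total at a.
  redVertex : Fin p → Bool
  redVertex a = odd (rowBlue a) ∨ (rowBlue a ≡ᵇ 0)

  rowDeg-split : ∀ a → rowDeg a ≡ rowRed a + rowBlue a
  rowDeg-split a = count-split (E a) (isRed a)

  colDeg-split : ∀ l → colDeg l ≡ colRed l + colBlue l
  colDeg-split l = count-split (λ a → E a l) (λ a → isRed a l)

  isRed-claimed : ∀ {a c l} → f l ≡ just c → isRed a l ≡ isColor a c
  isRed-claimed {a} {l = l} e = cong (λ m → paint m (oddAbove1 (colDeg l)) a) e

  isRed-left : ∀ {a l} → f l ≡ nothing → isRed a l ≡ oddAbove1 (colDeg l)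
  isRed-left {a} {l} e = cong (λ m → paint m (oddAbove1 (colDeg l)) a) e

  claimed-colRed : ∀ {c l} → f l ≡ just c → colRed l ≡ 1
  claimed-colRed {c} {l} e = count-single c
    (cong₂ _∧_ (claim-edge C e) (trans (isRed-claimed e) (isColor-refl c)))
    λ a r → isColor⇒≡ (trans (sym (isRed-claimed e)) (proj₂ (∧-split r)))

  -- Only columns of odd degree are claimed, and exactly one of their edges is red.
  claimed-colBlue : ∀ {c l} → f l ≡ just c → odd (colBlue l) ≡ false
  claimed-colBlue {l = l} e = Bool.not-injective (begin
    not (odd (colBlue l))         ≡⟨ cong (λ d → odd (d + colBlue l)) (claimed-colRed e) ⟨
    odd (colRed l + colBlue l)    ≡⟨ cong odd (colDeg-split l) ⟨
    odd (colDeg l)                ≡⟨ claim-free C e ⟩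
    true                          ∎)
    where open ≡-Reasoning

  left-colBlue : ∀ {l} → f l ≡ nothing → oddAbove1 (colDeg l) ≡ false → colBlue l ≡ colDeg l
  left-colBlue {l} n v = count-cong λ a →
    trans (cong (λ b → E a l ∧ not b) (trans (isRed-left n) v)) (∧-identityʳ _)

  left-colRed : ∀ {l} → f l ≡ nothing → oddAbove1 (colDeg l) ≡ true → colRed l ≡ colDeg l
  left-colRed {l} n v = count-cong λ a →
    trans (cong (E a l ∧_) (trans (isRed-left n) v)) (∧-identityʳ _)

  claimed-red : ∀ {a c l} → f l ≡ just c → isRed a l ≡ true → a ≡ c
  claimed-red e r = isColor⇒≡ (trans (sym (isRed-claimed e)) r)

  -- A red edge from `a` to a claimed column would make `a` its owner, against `left-idle`; a red
  -- edge to an unclaimed column means that its degree is odd, so `left-unique` applies.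
  left-rowRed : ∀ {a l l′} → f l ≡ nothing → odd (colDeg l) ≡ true → E a l ≡ true →
    E a l′ ∧ isRed a l′ ≡ true → l′ ≡ l
  left-rowRed {a} {l} {l′} n o e er with ∧-split er
  ... | e′ , r = by (f l′) refl
    where
    by : ∀ m → f l′ ≡ m → l′ ≡ l
    by (just c) j =
      contradiction (trans j (cong just (sym (claimed-red j r)))) (left-idle C n o e l′)
    by nothing n′ =
      left-unique C n′ (proj₁ (∧-split (trans (sym (isRed-left n′)) r))) e′ n o e

  -- The blue edge rules out `rowBlue a ≡ 0`, so the vertex is blue exactly when its blue degree is
  -- even.
  rowBlue-odd : ∀ {a l} → E a l ≡ true → isRed a l ≡ false →
    odd (rowBlue a + bit (not (redVertex a))) ≡ true
  rowBlue-odd {a} {l} e b = trans (odd-+ (rowBlue a) _)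
    (total (rowBlue a) (count≢0 l (cong₂ (λ x y → x ∧ not y) e b)))
    where
    total : ∀ d → d ≢ 0 → odd d xor odd (bit (not (odd d ∨ (d ≡ᵇ 0)))) ≡ true
    total zero    d≢0 = contradiction refl d≢0
    total (suc d) _ with odd d
    ... | true  = refl
    ... | false = refl

  red-differs : ∀ {a l} → E a l ≡ true → isRed a l ≡ true →
    rowRed a + bit (redVertex a) ≢ colRed l
  red-differs {a} {l} e r = by (f l) refl
    where
    er : E a l ∧ isRed a l ≡ true
    er = cong₂ _∧_ e r

    -- The nonzero `m` already uses up the total 1, so the vertex is blue. Hence `d` is even and
    -- positive, and `1 + d` is odd and above 1.
    lone : ∀ m d → m ≢ 0 → m + bit (odd d ∨ (d ≡ᵇ 0)) ≡ 1 → m ≡ 1 × oddAbove1 (m + d) ≡ true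
    lone zero          d       m≢0 eq = contradiction refl m≢0
    lone 1             (suc d) m≢0 eq with odd d
    ... | true = refl , refl

    absorbed : ∀ d → oddAbove1 (suc d) ≡ true → bit (odd d ∨ (d ≡ᵇ 0)) ≡ 0
    absorbed (suc d) v with odd d
    ... | true = refl

    by : ∀ m → f l ≡ m → rowRed a + bit (redVertex a) ≢ colRed l
    by (just c) j eq with claimed-red j r
    ... | refl with lone (rowRed a) (rowBlue a) (count≢0 l er) (trans eq (claimed-colRed j))
    -- Red total 1 at the owner `a` makes `a` shy, so it owns a second column, and thus has a second
    -- red edge.
    ...   | one , shy with shy-claim C (trans (cong oddAbove1 (rowDeg-split a)) shy) j
    ...     | l′ , l′≢l , j′ = l′≢l (count≡1⇒unique one
                (cong₂ _∧_ (claim-edge C j′) (trans (isRed-claimed j′) (isColor-refl a))) er)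
    by nothing n eq = oddAbove1⇒≢1 v (begin
      colDeg l                         ≡⟨ left-colRed n v ⟨
      colRed l                         ≡⟨ eq ⟨
      rowRed a + bit (redVertex a)     ≡⟨ cong₂ _+_ one (absorbed (rowBlue a) shy) ⟩
      1                                ∎)
      where
      open ≡-Reasoning
      v : oddAbove1 (colDeg l) ≡ true
      v = trans (sym (isRed-left n)) r
      o : odd (colDeg l) ≡ true
      o = proj₁ (∧-split v)
      one : rowRed a ≡ 1
      one = count-single l er λ _ → left-rowRed n o e
      shy : oddAbove1 (suc (rowBlue a)) ≡ true
      shy = trans (cong oddAbove1 (sym (trans (rowDeg-split a) (cong (_+ rowBlue a) one))))
                  (left-shy C n o e)

  blue-differs : ∀ {a l} → E a l ≡ true → isRed a l ≡ false →
    rowBlue a + bit (not (redVertex a)) ≢ colBlue l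
  blue-differs {a} {l} e b = by (f l) refl
    where
    bulky : ∀ d → oddAbove1 d ≡ true → d + bit (not (odd d ∨ (d ≡ᵇ 0))) ≢ 1
    bulky d v eq rewrite ∧-conicalˡ (odd d) _ v = oddAbove1⇒≢1 v (trans (sym (+-identityʳ d)) eq)

    by : ∀ m → f l ≡ m → rowBlue a + bit (not (redVertex a)) ≢ colBlue l
    by (just c) j = differ (rowBlue-odd e b) (claimed-colBlue j)
    by nothing n = by-parity (odd (colDeg l)) refl
      where
      by-parity : ∀ x → odd (colDeg l) ≡ x → rowBlue a + bit (not (redVertex a)) ≢ colBlue l
      by-parity false o = differ (rowBlue-odd e b)
        (trans (cong odd (left-colBlue n (cong (_∧ not (colDeg l ≡ᵇ 1)) o))) o)
      by-parity true o eq = bulky (rowBlue a) shy (trans eq one)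
        where
        v : oddAbove1 (colDeg l) ≡ false
        v = trans (sym (isRed-left n)) b
        one : colBlue l ≡ 1
        one = trans (left-colBlue n v) (¬oddAbove1⇒≡1 o v)
        -- By `left-rowRed` a red edge at `a` could only end in `l`, but that edge is blue.
        none : rowRed a ≡ 0
        none = count-none λ l′ er →
          true≢false (proj₂ (∧-split {E a l′} er)) (trans (cong (isRed a) (left-rowRed n o e er)) b)
        shy : oddAbove1 (rowBlue a) ≡ true
        shy = trans (cong oddAbove1 (sym (trans (rowDeg-split a) (cong (_+ rowBlue a) none))))
                    (left-shy C n o e)

-- The enlarged palette, and total degrees as counts.

private variable
  n k : ℕ

isZero : Fin (suc k) → Bool
isZero zero    = true
isZero (suc _) = false

isZero-≢ : {c d : Fin (suc k)} → isZero c ≡ true → isZero d ≡ true → c ≡ d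
isZero-≢ {c = zero} {zero} _ _ = refl

hue : Bool → Fin (2 + k)
hue true  = zero
hue false = suc zero

raise : Fin k → Fin (2 + k)
raise c = suc (suc c)

isColor-suc : (c d : Fin k) → isColor (suc c) (suc d) ≡ isColor c d
isColor-suc c d with c ≟ d
... | yes _ = refl
... | no _  = refl

isColor-raise : (c d : Fin k) → isColor (raise c) (raise d) ≡ isColor c d
isColor-raise c d = trans (isColor-suc (suc c) (suc d)) (isColor-suc c d)

-- Equality of Booleans, split on the first argument so that `matches true` and `matches false`
-- reduce to the red and blue predicates of `Bipartite`.
matches : Bool → Bool → Bool
matches true  b = b
matches false b = not b

isColor-hue : ∀ b x → isColor {2 + k} (hue b) (hue x) ≡ matches x b
isColor-hue true  true  = refl
isColor-hue true  false = refl
isColor-hue false true  = refl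
isColor-hue false false = refl

isColor-hue-raise : ∀ b (c : Fin k) → isColor (hue b) (raise c) ≡ false
isColor-hue-raise true  c = refl
isColor-hue-raise false c = refl

isColor-raise-hue : ∀ (c : Fin k) x → isColor (raise c) (hue x) ≡ false
isColor-raise-hue c true  = refl
isColor-raise-hue c false = refl

totalDeg-count : {G : Graph n} (T : TotalColoring G k) (c : Fin k) (v : Fin n) →
  totalDeg T c v ≡ count (λ w → adj G v w ∧ isColor (ecol T v w) c) + bit (isColor (vcol T v) c)
totalDeg-count {G = G} T c v = cong (_+ bit (isColor (vcol T v) c))
  (countTrue-tabulate (λ w → adj G v w ∧ isColor (ecol T v w) c) id)

-- Base case: two colour classes.

bipartite-TLIR : (G : Graph n) → Colorable G 2 → HasTLIR G 2
bipartite-TLIR {n} G (f , proper) = T , irregular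
  where
  x : Fin n → Bool
  -- The degree parity cancels against the edges at `v`, leaving `isZero (f v)` as the parity of the
  -- total degree in the only edge colour.
  x v = odd (count (adj G v)) xor isZero (f v)

  T : TotalColoring G 2
  T = record { vcol = hue ∘ x ; ecol = λ _ _ → zero ; ecolSym = λ _ _ _ → refl }

  parity : ∀ v → odd (totalDeg T zero v) ≡ isZero (f v)
  parity v = begin
    odd (totalDeg T zero v)
      ≡⟨ cong odd (totalDeg-count T zero v) ⟩
    odd (count (λ w → adj G v w ∧ true) + bit (isColor (hue {0} (x v)) zero))
      ≡⟨ cong₂ (λ d b → odd (d + bit b)) (count-cong λ w → ∧-identityʳ (adj G v w))
           (isColor-hue {0} (x v) true) ⟩
    odd (count (adj G v) + bit (x v))
      ≡⟨ odd-+ (count (adj G v)) _ ⟩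
    odd (count (adj G v)) xor odd (bit (x v))
      ≡⟨ cong (odd (count (adj G v)) xor_) (odd-bit (x v)) ⟩
    odd (count (adj G v)) xor x v
      ≡⟨ xor-assoc (odd (count (adj G v))) _ _ ⟨
    (odd (count (adj G v)) xor odd (count (adj G v))) xor isZero (f v)
      ≡⟨ cong (_xor isZero (f v)) (xor-same (odd (count (adj G v)))) ⟩
    isZero (f v) ∎
    where open ≡-Reasoning

  isZero-injective : ∀ {c d : Fin 2} → isZero c ≡ isZero d → c ≡ d
  isZero-injective {zero}     {zero}     _ = refl
  isZero-injective {suc zero} {suc zero} _ = refl

  irregular : IsTLIR T
  irregular u v uv e = proper u v uv
    (isZero-injective (trans (sym (parity u)) (trans (cong odd e) (parity v))))

-- Inductive step: adding an independent set back.

delete : Graph n → (Fin n → Bool) → Graph n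
delete G A = record
  -- The vertex set is kept, which avoids reindexing; vertices of `A` become isolated.
  { adj    = λ u v → (not (A u) ∧ not (A v)) ∧ adj G u v
  ; sym    = λ u v → cong₂ _∧_ (∧-comm (not (A u)) (not (A v))) (Graph.sym G u v)
  ; irrefl = λ v → trans (cong (_ ∧_) (irrefl G v)) (∧-zeroʳ _)
  }

module Extend {n k} (G : Graph n) (A : Fin n → Bool)
  (independent : ∀ {u v} → A u ≡ true → A v ≡ true → adj G u v ≡ false)
  (T : TotalColoring (delete G A) k) (tlir : IsTLIR T) where

  -- Both sides are indexed by all vertices: rows outside `A` and columns inside `A` simply have
  -- degree 0.
  E : Fin n → Fin n → Bool
  E a l = (A a ∧ not (A l)) ∧ adj G a l

  open Bipartite E

  -- `r` and `s` are the redness of the edge with its first or its second end as the row. The value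
  -- for two ends in `A` is a default, as no such edge exists.
  mix : Bool → Bool → Bool → Bool → Fin k → Fin (2 + k)
  mix true  true  r s c = zero
  mix true  false r s c = hue r
  mix false true  r s c = hue s
  mix false false r s c = raise c

  colour : Fin n → Fin n → Fin (2 + k)
  colour u v = mix (A u) (A v) (isRed u v) (isRed v u) (ecol T u v)

  colourSym : ∀ u v → Adj G u v → colour u v ≡ colour v u
  colourSym u v uv with A u in Au | A v in Av
  ... | true  | true  = refl
  ... | true  | false = refl
  ... | false | true  = refl
  ... | false | false =
    cong raise (ecolSym T u v (cong₂ _∧_ (cong₂ (λ x y → not x ∧ not y) Au Av) uv))

  vertexColour : Bool → Fin n → Fin (2 + k)
  vertexColour b v = if b then hue (redVertex v) else raise (vcol T v)

  T⁺ : TotalColoring G (2 + k)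
  T⁺ = record
    { vcol    = λ v → vertexColour (A v) v
    ; ecol    = colour
    ; ecolSym = colourSym
    }

  -- Stated for bare Booleans, this and the next two lemmas hold by case analysis without
  -- abstracting `A v` and `A w` in the goals that use them.
  hue-at-A : ∀ p q g r s c x → p ≡ true → (q ≡ true → g ≡ false) →
    g ∧ isColor (mix p q r s c) (hue x) ≡ ((p ∧ not q) ∧ g) ∧ matches x r
  hue-at-A true true  g r s c x refl h rewrite h refl = refl
  hue-at-A true false g r s c x refl h = cong (g ∧_) (isColor-hue r x)

  hue-off-A : ∀ p q g r s c x → p ≡ false →
    g ∧ isColor (mix p q r s c) (hue x) ≡ ((q ∧ not p) ∧ g) ∧ matches x s
  hue-off-A false true  g r s c x refl = cong (g ∧_) (isColor-hue s x)
  hue-off-A false false g r s c x refl =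
    trans (cong (g ∧_) (isColor-raise-hue c x)) (∧-zeroʳ g)

  raise-off-A : ∀ p q g r s c d → p ≡ false →
    g ∧ isColor (mix p q r s c) (raise d) ≡ ((not p ∧ not q) ∧ g) ∧ isColor c d
  raise-off-A false true  g r s c d refl =
    trans (cong (g ∧_) (isColor-hue-raise s d)) (∧-zeroʳ g)
  raise-off-A false false g r s c d refl = cong (g ∧_) (isColor-raise c d)

  hueDeg-at-A : ∀ {v} x → A v ≡ true → totalDeg T⁺ (hue x) v ≡
    count (λ w → E v w ∧ matches x (isRed v w)) + bit (matches x (redVertex v))
  hueDeg-at-A {v} x Av = trans (totalDeg-count T⁺ (hue x) v) (cong₂ (λ d b → d + bit b)
    (count-cong λ w → hue-at-A (A v) (A w) (adj G v w) _ _ _ x Av (independent Av))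
    (trans (cong (λ b → isColor (vertexColour b v) (hue x)) Av) (isColor-hue (redVertex v) x)))

  hueDeg-off-A : ∀ {v} x → A v ≡ false → totalDeg T⁺ (hue x) v ≡
    count (λ w → E w v ∧ matches x (isRed w v))
  hueDeg-off-A {v} x Av = trans (totalDeg-count T⁺ (hue x) v) (trans (cong₂ (λ d b → d + bit b)
    (count-cong λ w → trans (hue-off-A (A v) (A w) (adj G v w) _ _ _ x Av)
      (cong (λ g → ((A w ∧ not (A v)) ∧ g) ∧ matches x (isRed w v)) (Graph.sym G v w)))
    (trans (cong (λ b → isColor (vertexColour b v) (hue x)) Av) (isColor-raise-hue (vcol T v) x)))
    (+-identityʳ _))

  -- Edges that meet `A` are red or blue and contribute nothing to a raised colour.
  raiseDeg : ∀ {v} c → A v ≡ false → totalDeg T⁺ (raise c) v ≡ totalDeg T c v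
  raiseDeg {v} c Av = trans (totalDeg-count T⁺ (raise c) v) (trans (cong₂ (λ d b → d + bit b)
    (count-cong λ w → raise-off-A (A v) (A w) (adj G v w) _ _ _ c Av)
    (trans (cong (λ b → isColor (vertexColour b v) (raise c)) Av) (isColor-raise (vcol T v) c)))
    (sym (totalDeg-count T c v)))

  cross-differs : ∀ {u v} → A u ≡ true → A v ≡ false → Adj G u v → ∀ x → isRed u v ≡ x →
    totalDeg T⁺ (hue x) u ≢ totalDeg T⁺ (hue x) v
  cross-differs {u} {v} Au Av uv x r eq = by x r (begin
      _                        ≡⟨ hueDeg-at-A x Au ⟨
      totalDeg T⁺ (hue x) u    ≡⟨ eq ⟩
      totalDeg T⁺ (hue x) v    ≡⟨ hueDeg-off-A x Av ⟩
      _                        ∎)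
    where
    open ≡-Reasoning
    e : E u v ≡ true
    e = cong₂ _∧_ (cong₂ (λ b c → b ∧ not c) Au Av) uv

    by : ∀ x → isRed u v ≡ x →
      count (λ w → E u w ∧ matches x (isRed u w)) + bit (matches x (redVertex u)) ≢
      count (λ w → E w v ∧ matches x (isRed w v))
    by true  = red-differs e
    by false = blue-differs e

  T⁺-irregular : IsTLIR T⁺
  T⁺-irregular u v uv = by (A u) (A v) refl refl
    where
    Differ : Fin (2 + k) → Set
    Differ c = totalDeg T⁺ c u ≢ totalDeg T⁺ c v

    mixed : ∀ {x y} → A u ≡ x → A v ≡ y →
      mix x y (isRed u v) (isRed v u) (ecol T u v) ≡ colour u v
    mixed Au Av = cong₂ (λ x y → mix x y (isRed u v) (isRed v u) (ecol T u v)) (sym Au) (sym Av)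

    by : ∀ x y → A u ≡ x → A v ≡ y → Differ (colour u v)
    by true  true  Au Av = contradiction (independent Au Av) (true≢false uv)
    by true  false Au Av = subst Differ (mixed Au Av) (cross-differs Au Av uv _ refl)
    -- The edge is reversed to put its end in `A` first.
    by false true  Au Av = subst Differ (mixed Au Av)
      (cross-differs Av Au (trans (Graph.sym G v u) uv) _ refl ∘ sym)
    by false false Au Av = subst Differ (mixed Au Av) λ eq →
      tlir u v (cong₂ _∧_ (cong₂ (λ x y → not x ∧ not y) Au Av) uv)
        (trans (sym (raiseDeg _ Au)) (trans eq (raiseDeg _ Av)))

-- Induction on the number of colour classes.

drop : Fin (2 + k) → Fin (suc k)
-- A default: the vertices of colour `zero` are isolated once their class is deleted.
drop zero    = zero
drop (suc c) = c

drop-injective : {c d : Fin (2 + k)} → not (isZero c) ∧ not (isZero d) ≡ true →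
  drop c ≡ drop d → c ≡ d
drop-injective {c = suc c} {suc d} _ e = cong suc e

-- Two colours suffice for two classes, and each further class costs two more; `2 + suc k * 2`
-- computes to the palette of `T⁺`.
colorable-TLIR : ∀ k (G : Graph n) → Colorable G (2 + k) → HasTLIR G (2 + k * 2)
colorable-TLIR zero    G col = bipartite-TLIR G col
colorable-TLIR (suc k) G (f , proper) = T⁺ , T⁺-irregular
  where
  A = isZero ∘ f

  rest : HasTLIR (delete G A) (2 + k * 2)
  rest = colorable-TLIR k (delete G A) (drop ∘ f , λ u v uv e →
    let off , uv′ = ∧-split {not (A u) ∧ not (A v)} uv in
    proper u v uv′ (drop-injective off e))

  open Extend G A
    (λ {u} {v} Au Av → ¬-not λ uv → proper u v uv (isZero-≢ Au Av))
    (proj₁ rest) (proj₂ rest)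

theorem4 : ∀ (n : ℕ) (G : Graph n) (χ : ℕ) → IsChromaticNumber G χ → 2 ≤ χ →
    HasTLIR G (2 * χ ∸ 2)
theorem4 n G (suc (suc k)) (col , _) (s≤s (s≤s _)) =
  -- `(2 + k) * 2 ∸ 2` computes to `2 + k * 2`, so only the factors need swapping.
  subst (HasTLIR G) (cong (_∸ 2) (*-comm (2 + k) 2)) (colorable-TLIR k G col)
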